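{- For any nonempty zero-set $\mathcal{Z}$, with $s=s(\mathcal{Z})$, we have $\mu_{\mathrm{en}}(\mathcal{Z})\ge s^{1/2}$ and $\mu(\mathcal{Z})\ge\mu_{\mathrm{th}}(\mathcal{Z})\ge(s-1)^{1/2}$.
   Context: $\mathbb{Z}_+=\{0,1,2,\dots\}$, $\mathbb{N}=\{1,2,\dots\}$. For $a,b\in\mathbb{N}$, $R_{a,b}=([0,a-1]\times[0,b-1])\cap\mathbb{Z}_+^2$. A zero-set is a union $\mathcal{Z}=\bigcup_{(a,b)\in\mathcal{I}}R_{a,b}$ over a finite $\mathcal{I}\subseteq\mathbb{N}^2$. $s(\mathcal{Z})$ is the integer $s\ge0$ with $R_{s,s}\subseteq\mathcal{Z}$ but $R_{s+1,s+1}\not\subseteq\mathcal{Z}$. For $x\in\mathbb{Z}_+^2$, $L^h(x),L^v(x)$ are the horizontal and vertical lines through $x$; for $A\subseteq\mathbb{Z}_+^2$, $\mathtt{row}(x,A)=|L^h(x)\cap A|$, $\mathtt{col}(x,A)=|L^v(x)\cap A|$. Regular dynamics: $\mathcal{T}(A)=A\cup\{x\notin A:(\mathtt{row}(x,A),\mathtt{col}(x,A))\notin\mathcal{Z}\}$; $A$ spans if $\bigcup_t\mathcal{T}^t(A)=\mathbb{Z}_+^2$; for finite spanning $A$, $\tau(\mathcal{Z},A)=\min\{t\in\mathbb{N}:\mathcal{T}^t(A)=\mathbb{Z}_+^2\}$; $\mu(\mathcal{Z})=\sup$ of $\tau(\mathcal{Z},A)$ over finite spanning $A$. A finite set $A$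 is thin if for every $x\in A$, $\mathtt{row}(x,A)=1$ or $\mathtt{col}(x,A)=1$; $\mu_{\mathrm{th}}(\mathcal{Z})=\max\{\tau(\mathcal{Z},A):A\text{ thin and spanning}\}$. Enhanced dynamics: enhancements $\vec r=(r_0,r_1,\dots)$, $\vec c=(c_0,c_1,\dots)$ are weakly decreasing sequences of nonnegative integers; $\mathcal{T}_{\mathrm{en}}(A)=A\cup\{(i,j):(\mathtt{row}((i,j),A)+r_j,\mathtt{col}((i,j),A)+c_i)\notin\mathcal{Z}\}$; $(\vec r,\vec c)$ spans for $\mathcal{Z}$ if $\bigcup_t\mathcal{T}_{\mathrm{en}}^t(\emptyset)=\mathbb{Z}_+^2$; $\tau_{\mathrm{en}}(\mathcal{Z},\vec r,\vec c)=\inf\{t\in\mathbb{N}:\mathcal{T}_{\mathrm{en}}^t(\emptyset)=\mathbb{Z}_+^2\}$; $\mu_{\mathrm{en}}(\mathcal{Z})$ is the maximum of $\tau_{\mathrm{en}}$ over spanning pairs with finite support. -}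

module Defs where

open import Data.Nat using (ℕ; zero; suc; _+_; _*_; _∸_; _≤_; _<_)
open import Data.Fin using (Fin)
open import Data.Product using (Σ; _×_; _,_; proj₁; proj₂)
open import Data.Sum using (_⊎_)
open import Data.List using (List; [])
open import Data.List.Relation.Unary.All using (All)
open import Data.List.Relation.Unary.Any using (Any)
open import Data.List.Membership.Propositional using (_∈_)
open import Relation.Binary.PropositionalEquality using (_≡_)
open import Relation.Nullary using (¬_)
open import Function.Definitions using (Injective)

-- Points of ℤ₊² are pairs (i , j) : ℕ × ℕ.
-- A (possibly infinite) subset of ℤ₊² is a predicate.
Subset² : Set₁
Subset² = ℕ → ℕ → Set

-- A zero-set is given by a finite index list I ⊆ ℕ² (entries ≥ 1):
-- Z = ⋃_{(a,b) ∈ I} R_{a,b}.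
ValidIndex : List (ℕ × ℕ) → Set
ValidIndex I = All (λ ab → 1 ≤ proj₁ ab × 1 ≤ proj₂ ab) I

InZ : List (ℕ × ℕ) → ℕ → ℕ → Set
InZ I p q = Any (λ ab → p < proj₁ ab × q < proj₂ ab) I

IsS : List (ℕ × ℕ) → ℕ → Set
IsS I s = (∀ p q → p < s → q < s → InZ I p q)
        × ¬ (∀ p q → p < suc s → q < suc s → InZ I p q)

-- "the set {k : P k} has at least n elements" (works for infinite sets).
AtLeast : ℕ → (ℕ → Set) → Set
AtLeast n P = Σ (Fin n → ℕ) (λ f → Injective _≡_ _≡_ f × (∀ k → P (f k)))

-- (row , col) ∉ Z, where rowGe a means "row ≥ a", colGe b means "col ≥ b".
-- Since Z = ⋃ R_{a,b}, (row,col) ∉ Z iff for every (a,b) ∈ I,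
-- row ≥ a or col ≥ b.  (Counts may be infinite, hence this form.)
NotInZ : List (ℕ × ℕ) → (ℕ → Set) → (ℕ → Set) → Set
NotInZ I rowGe colGe = All (λ ab → rowGe (proj₁ ab) ⊎ colGe (proj₂ ab)) I

RowGe : Subset² → ℕ → ℕ → ℕ → Set
RowGe A i j a = AtLeast a (λ i' → A i' j)

ColGe : Subset² → ℕ → ℕ → ℕ → Set
ColGe A i j b = AtLeast b (λ j' → A i j')

T : List (ℕ × ℕ) → Subset² → Subset²
T I A i j = A i j ⊎ (¬ A i j × NotInZ I (RowGe A i j) (ColGe A i j))

iterate : (Subset² → Subset²) → ℕ → Subset² → Subset²
iterate F zero    A = A
iterate F (suc t) A = F (iterate F t A)

Full : Subset² → Set
Full A = ∀ i j → A i j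

⟦_⟧ : List (ℕ × ℕ) → Subset²
⟦ A ⟧ i j = (i , j) ∈ A

Spans : List (ℕ × ℕ) → List (ℕ × ℕ) → Set
Spans I A = ∀ i j → Σ ℕ (λ t → iterate (T I) t ⟦ A ⟧ i j)

-- τ(Z,A) = t : t is the least t ∈ ℕ = {1,2,…} with T^t(A) = ℤ₊².
Tau : List (ℕ × ℕ) → List (ℕ × ℕ) → ℕ → Set
Tau I A t = 1 ≤ t × Full (iterate (T I) t ⟦ A ⟧)
          × (∀ t' → 1 ≤ t' → t' < t → ¬ Full (iterate (T I) t' ⟦ A ⟧))

Thin : List (ℕ × ℕ) → Set
Thin A = ∀ x → x ∈ A →
  (∀ y → y ∈ A → proj₂ y ≡ proj₂ x → y ≡ x)
  ⊎ (∀ y → y ∈ A → proj₁ y ≡ proj₁ x → y ≡ x)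

WeaklyDecreasing : (ℕ → ℕ) → Set
WeaklyDecreasing r = ∀ m n → m ≤ n → r n ≤ r m

FiniteSupport : (ℕ → ℕ) → Set
FiniteSupport r = Σ ℕ (λ N → ∀ n → N ≤ n → r n ≡ 0)

-- Enhanced dynamics: (i,j) is added iff (row + r_j , col + c_i) ∉ Z;
-- "row + r_j ≥ a" is expressed as "row ≥ a ∸ r_j" (counts may be infinite).
Ten : List (ℕ × ℕ) → (ℕ → ℕ) → (ℕ → ℕ) → Subset² → Subset²
Ten I r c A i j = A i j ⊎
  NotInZ I (λ a → RowGe A i j (a ∸ r j)) (λ b → ColGe A i j (b ∸ c i))

∅ : Subset²
∅ i j = Data.Empty.⊥
  where import Data.Empty

SpansEn : List (ℕ × ℕ) → (ℕ → ℕ) → (ℕ → ℕ) → Set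
SpansEn I r c = ∀ i j → Σ ℕ (λ t → iterate (Ten I r c) t ∅ i j)

TauEn : List (ℕ × ℕ) → (ℕ → ℕ) → (ℕ → ℕ) → ℕ → Set
TauEn I r c t = 1 ≤ t × Full (iterate (Ten I r c) t ∅)
              × (∀ t' → 1 ≤ t' → t' < t → ¬ Full (iterate (Ten I r c) t' ∅))

{-# OPTIONS --safe #-}

-- Let a y be the length of row y of Z and T about √s.  Starting at the last row of the square, repeatedly move
-- from row y to a row y′ ≥ y ∸ T with a y′ ≥ a y ∸ T and a larger value of a y + y.
-- If this gets stuck while y ≥ T and a y > T, the end of row y maximizes the sum of the coordinates over the
-- points of Z in the quadrant whose corner lies T below and T to the left of it.  Enhancements decreasing with
-- slope one around that point then complete at most one row and one column per step, for T steps, but do not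
-- stall: along an antidiagonal a partially filled row gains what the columns lose.
-- Otherwise y or a y has dropped from s to about T in steps of at most T, so the visited rows have at least
-- s / T - 1 distinct lengths; with r j = a (j + 1) and c i = 1 each of these lengths costs a step.
-- A thin set realizes (r , c) by giving row j its r j cells in private columns and column i its c i cells in
-- private rows.

module Submission where

open import Defs
open import Data.Nat
open import Data.Nat.Properties
open import Data.Nat.DivMod using (m*n/n≡m; m<n⇒m/n≡0; +-distrib-/-∣ʳ)
open import Data.Nat.Divisibility using (n∣m*n)
open import Data.Nat.Tactic.RingSolver using (solve-∀)
open import Data.Fin as Fin using (Fin; toℕ; inject≤; splitAt)
open import Data.Fin.Properties using (toℕ-injective; toℕ<n; inject≤-injective; injective⇒≤; any?; join-splitAt)
open import Data.Product using (Σ; _×_; _,_; proj₁; proj₂; swap)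
open import Data.Sum as Sum using (_⊎_; inj₁; inj₂; [_,_]′)
open import Data.Empty using (⊥-elim)
open import Data.List using (List; []; _∷_; length; lookup; filter; upTo; _++_; map; cartesianProduct)
open import Data.List.Properties using (length-++; length-map; length-upTo)
open import Data.List.Relation.Unary.All as All using (All; []; _∷_)
open import Data.List.Relation.Unary.All.Properties using (¬Any⇒All¬)
open import Data.List.Relation.Unary.Any as Any using (here; there; index)
open import Data.List.Relation.Unary.Any.Properties using (lookup-index)
open import Data.List.Relation.Unary.Unique.Propositional using (Unique; []; _∷_)
open import Data.List.Relation.Unary.Unique.Propositional.Properties using (filter⁺; upTo⁺)
open import Data.List.Membership.Propositional using (_∈_; find)
open import Data.List.Membership.Propositional.Properties using (∈-upTo⁺; ∈-filter⁺; ∈-filter⁻; ∈-cartesianProduct⁺; ∈-++⁺ˡ; ∈-++⁺ʳ; ∈-map⁺; ∈-lookup)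
open import Function using (_∘_; id)
open import Relation.Binary.PropositionalEquality
open import Relation.Nullary using (¬_; Dec; yes; no; contradiction)
open import Relation.Nullary.Decidable using (_×-dec_; _⊎-dec_; map′)
open import Relation.Unary using (Decidable)

Points : Set
Points = List (ℕ × ℕ)

-- Counting

AtLeast-≤ : ∀ (P : ℕ → Set) {m n} → m ≤ n → AtLeast n P → AtLeast m P
AtLeast-≤ _ m≤n (f , f-inj , Pf) =
  (λ k → f (inject≤ k m≤n)) , (λ eq → inject≤-injective m≤n m≤n _ _ (f-inj eq)) , λ k → Pf (inject≤ k m≤n)

AtLeast-⊆ : ∀ {n} {P Q : ℕ → Set} → (∀ x → P x → Q x) → AtLeast n P → AtLeast n Q
AtLeast-⊆ P⊆Q (f , f-inj , Pf) = f , f-inj , λ k → P⊆Q (f k) (Pf k)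

AtLeast-initial : ∀ {n} {P : ℕ → Set} → (∀ x → x < n → P x) → AtLeast n P
AtLeast-initial P< = toℕ , toℕ-injective , λ k → P< (toℕ k) (toℕ<n k)

AtLeast-tail : ∀ {P : ℕ → Set} M n → (∀ x → M ≤ x → P x) → AtLeast n P
AtLeast-tail M n P≥ =
  (λ k → M + toℕ k) , (λ eq → toℕ-injective (+-cancelˡ-≡ M _ _ eq)) , λ k → P≥ _ (m≤m+n M (toℕ k))

AtLeast-+ : ∀ {m n} {P Q R : ℕ → Set} → (∀ x → P x → R x) → (∀ x → Q x → R x) →
  (∀ x → P x → ¬ Q x) → AtLeast m P → AtLeast n Q → AtLeast (m + n) R
AtLeast-+ {m} {n} {P} {Q} {R} P⊆R Q⊆R disj (f , f-inj , Pf) (g , g-inj , Qg) =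
  h ∘ splitAt m , split-inj , λ k → h∈R (splitAt m k)
  where
  h : Fin m ⊎ Fin n → ℕ
  h = [ f , g ]′

  h∈R : ∀ k → R (h k)
  h∈R (inj₁ k) = P⊆R (f k) (Pf k)
  h∈R (inj₂ k) = Q⊆R (g k) (Qg k)

  h-inj : ∀ k l → h k ≡ h l → k ≡ l
  h-inj (inj₁ k) (inj₁ l) eq = cong inj₁ (f-inj eq)
  h-inj (inj₁ k) (inj₂ l) eq = ⊥-elim (disj (f k) (Pf k) (subst Q (sym eq) (Qg l)))
  h-inj (inj₂ k) (inj₁ l) eq = ⊥-elim (disj (f l) (Pf l) (subst Q eq (Qg k)))
  h-inj (inj₂ k) (inj₂ l) eq = cong inj₂ (g-inj eq)

  split-inj : ∀ {k l} → h (splitAt m k) ≡ h (splitAt m l) → k ≡ l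
  split-inj {k} {l} eq = trans (sym (join-splitAt m n k))
    (trans (cong (Fin.join m n) (h-inj (splitAt m k) (splitAt m l) eq)) (join-splitAt m n l))

AtLeast⇒≤length : ∀ {n} {P : ℕ → Set} L → (∀ x → P x → x ∈ L) → AtLeast n P → n ≤ length L
AtLeast⇒≤length L P⊆L (f , f-inj , Pf) = injective⇒≤ index-inj
  where
  position : ∀ k → f k ∈ L
  position k = P⊆L (f k) (Pf k)

  index-inj : ∀ {k l} → index (position k) ≡ index (position l) → k ≡ l
  index-inj {k} {l} eq = f-inj (trans (lookup-index (position k))
    (trans (cong (lookup L) eq) (sym (lookup-index (position l)))))

lookup-injective : ∀ {L : List ℕ} → Unique L → ∀ {k l} → lookup L k ≡ lookup L l → k ≡ l
lookup-injective (_ ∷ _) {Fin.zero}  {Fin.zero}  _ = refl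
lookup-injective (x∉ ∷ _) {Fin.zero}  {Fin.suc l} eq = contradiction eq (All.lookup x∉ (∈-lookup l))
lookup-injective (x∉ ∷ _) {Fin.suc k} {Fin.zero}  eq = contradiction (sym eq) (All.lookup x∉ (∈-lookup k))
lookup-injective (_ ∷ u) {Fin.suc k} {Fin.suc l} eq = cong Fin.suc (lookup-injective u eq)

-- Membership is constant from `M` on: if `M` belongs to `P`, so does the whole tail, and otherwise
-- `P` lies below `M` and can be listed.
atLeast? : ∀ {P : ℕ → Set} → Decidable P → ∀ M → (∀ {x y} → M ≤ x → M ≤ y → P x → P y) →
  ∀ n → Dec (AtLeast n P)
atLeast? {P} P? M tail n with P? M
... | yes PM = yes (AtLeast-tail M n λ x M≤x → tail ≤-refl M≤x PM)
... | no ¬PM with n ≤? length (filter P? (upTo M))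
...   | yes n≤ = yes (AtLeast-≤ P n≤
          ( lookup members
          , lookup-injective (filter⁺ P? (upTo⁺ M))
          , λ k → proj₂ (∈-filter⁻ P? {xs = upTo M} (∈-lookup k))))
  where members = filter P? (upTo M)
...   | no n≰ = no (n≰ ∘ AtLeast⇒≤length _ λ x Px → ∈-filter⁺ P? (∈-upTo⁺ (below x Px)) Px)
  where
  below : ∀ x → P x → x < M
  below x Px with x <? M
  ... | yes x<M = x<M
  ... | no x≮M = contradiction (tail (≮⇒≥ x≮M) ≤-refl Px) ¬PM

least : ∀ {P : ℕ → Set} → Decidable P → ∀ n → P n → Σ ℕ λ m → P m × (∀ k → k < m → ¬ P k)
least P? zero p = zero , p , λ _ ()
least P? (suc n) p with P? 0
... | yes p₀ = zero , p₀ , λ _ ()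
... | no ¬p₀ with least (P? ∘ suc) n p
...   | m , pm , minimal = suc m , pm , λ { zero _ → ¬p₀ ; (suc k) (s≤s k<m) → minimal k k<m }

-- Zero-sets

inZ? : ∀ I p q → Dec (InZ I p q)
inZ? I p q = Any.any? (λ ab → (p <? proj₁ ab) ×-dec (q <? proj₂ ab)) I

inZ-↓ : ∀ {I p q p′ q′} → p′ ≤ p → q′ ≤ q → InZ I p q → InZ I p′ q′
inZ-↓ p′≤p q′≤q = Any.map λ (p< , q<) → ≤-<-trans p′≤p p< , ≤-<-trans q′≤q q<

bounded : ∀ I → Σ ℕ λ B → ∀ {p q} → InZ I p q → p < B × q < B
bounded [] = 0 , λ ()
bounded ((a , b) ∷ I) with bounded I
... | B , inB = a ⊔ b ⊔ B , λ where
  (here (p<a , q<b)) → <-≤-trans p<a (≤-trans (m≤m⊔n a b) (m≤m⊔n (a ⊔ b) B))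
                     , <-≤-trans q<b (≤-trans (m≤n⊔m a b) (m≤m⊔n (a ⊔ b) B))
  (there z) → let p<B , q<B = inB z in
    <-≤-trans p<B (m≤n⊔m (a ⊔ b) B) , <-≤-trans q<B (m≤n⊔m (a ⊔ b) B)

rowLength : Points → ℕ → ℕ
rowLength [] q = 0
rowLength ((a , b) ∷ I) q with q <? b
... | yes _ = a ⊔ rowLength I q
... | no  _ = rowLength I q

inZ⇒<rowLength : ∀ I {p q} → InZ I p q → p < rowLength I q
inZ⇒<rowLength ((a , b) ∷ I) {p} {q} z with q <? b | z
... | yes _   | here (p<a , _) = <-≤-trans p<a (m≤m⊔n a _)
... | yes _   | there z′       = <-≤-trans (inZ⇒<rowLength I z′) (m≤n⊔m a _)
... | no q≮b  | here (_ , q<b) = contradiction q<b q≮b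
... | no _    | there z′       = inZ⇒<rowLength I z′

<rowLength⇒inZ : ∀ I {p q} → p < rowLength I q → InZ I p q
<rowLength⇒inZ ((a , b) ∷ I) {p} {q} p< with q <? b
... | no _ = there (<rowLength⇒inZ I p<)
... | yes q<b with p <? a
...   | yes p<a = here (p<a , q<b)
...   | no p≮a with ⊔-sel a (rowLength I q)
...     | inj₁ eq = contradiction (subst (p <_) eq p<) p≮a
...     | inj₂ eq = there (<rowLength⇒inZ I (subst (p <_) eq p<))

≤-from-< : ∀ {m n} → (∀ {k} → k < m → k < n) → m ≤ n
≤-from-< {zero}  f = z≤n
≤-from-< {suc m} f = f ≤-refl

rowLength-antitone : ∀ I {q q′} → q ≤ q′ → rowLength I q′ ≤ rowLength I q
rowLength-antitone I q≤q′ = ≤-from-< (inZ⇒<rowLength I ∘ inZ-↓ ≤-refl q≤q′ ∘ <rowLength⇒inZ I)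

-- Growth

module Growth (I : Points) (r c : ℕ → ℕ) (A : Subset²) where

  at : ℕ → Subset²
  at t = iterate (Ten I r c) t A

  at-mono : ∀ {t u} → t ≤ u → ∀ {i j} → at t i j → at u i j
  at-mono t≤u x = go (≤⇒≤′ t≤u) x
    where
    go : ∀ {t u} → t ≤′ u → ∀ {i j} → at t i j → at u i j
    go ≤′-refl x = x
    go (≤′-step t≤′u) x = inj₁ (go t≤′u x)

  notInZ : ∀ t {i j} X Y → AtLeast X (λ i′ → at t i′ j) → AtLeast Y (λ j′ → at t i j′) →
    ¬ InZ I (X + r j) (Y + c i) → at (suc t) i j
  notInZ t {i} {j} X Y row col out = inj₂ (All.map enough (¬Any⇒All¬ I out))
    where
    enough : ∀ {ab} → ¬ (X + r j < proj₁ ab × Y + c i < proj₂ ab) →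
      RowGe (at t) i j (proj₁ ab ∸ r j) ⊎ ColGe (at t) i j (proj₂ ab ∸ c i)
    enough {a , b} ¬< with a ≤? X + r j
    ... | yes a≤ = inj₁ (AtLeast-≤ (λ i′ → at t i′ j) (m≤n+o⇒m∸n≤o a (r j) (subst (a ≤_) (+-comm X (r j)) a≤)) row)
    ... | no a≰ = inj₂ (AtLeast-≤ (at t i) (m≤n+o⇒m∸n≤o b (c i)
            (subst (b ≤_) (+-comm Y (c i)) (≮⇒≥ λ b> → ¬< (≰⇒> a≰ , b>)))) col)

  fill : ∀ t {i j} X Y → (∀ i′ → i′ < X → at t i′ j) → (∀ j′ → j′ < Y → at t i j′) →
    ¬ InZ I (X + r j) (Y + c i) → at (suc t) i j
  fill t X Y row col = notInZ t X Y (AtLeast-initial row) (AtLeast-initial col)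

-- A certificate of slowness: by time `t` no point of the quadrant with corner `(k , ℓ)` has been
-- added. A row that meets the quadrant then has at most `k` cells left of it, and `R j` allows for
-- its initial cells together with `r j`; likewise `C i` for columns.
data Confined (I : Points) (R C : ℕ → ℕ) : ℕ → ℕ → ℕ → Set where
  start   : ∀ {k ℓ} → Confined I R C 0 k ℓ
  advance : ∀ {t k ℓ k′ ℓ′} → Confined I R C t k ℓ → k ≤ k′ → ℓ ≤ ℓ′ →
    (∀ {i j} → k′ ≤ i → ℓ′ ≤ j → InZ I (k + R j) (ℓ + C i)) → Confined I R C (suc t) k′ ℓ′

-- The upper bound on a count that is set against the lower bound `AtLeast`.
Coverable : (ℕ → Set) → ℕ → Set
Coverable P n = Σ (List ℕ) λ L → (∀ x → P x → x ∈ L) × length L ≤ n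

module _ {I : Points} {r c : ℕ → ℕ} {A : Subset²} {R C : ℕ → ℕ}
  (rows : ∀ j → Σ ℕ λ n → Coverable (λ i → A i j) n × n + r j ≤ R j)
  (cols : ∀ i → Σ ℕ λ n → Coverable (A i) n × n + c i ≤ C i) where

  open Growth I r c A

  private
    count : ∀ {P Q : ℕ → Set} {k n ρ R a} → (∀ x → P x → x < k ⊎ Q x) → Coverable Q n → n + ρ ≤ R →
      AtLeast (a ∸ ρ) P → a ≤ k + R
    count {P} {Q} {k} {n} {ρ} {R} {a} split (L , Q⊆L , |L|≤n) n+ρ≤R many = begin
      a                             ≤⟨ m≤n+m∸n a ρ ⟩
      ρ + (a ∸ ρ)                   ≤⟨ +-monoʳ-≤ ρ (AtLeast⇒≤length (upTo k ++ L) cover many) ⟩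
      ρ + length (upTo k ++ L)      ≡⟨ cong (ρ +_) (trans (length-++ (upTo k)) (cong (_+ length L) (length-upTo k))) ⟩
      ρ + (k + length L)            ≤⟨ +-monoʳ-≤ ρ (+-monoʳ-≤ k |L|≤n) ⟩
      ρ + (k + n)                   ≡⟨ +-comm ρ (k + n) ⟩
      (k + n) + ρ                   ≡⟨ +-assoc k n ρ ⟩
      k + (n + ρ)                   ≤⟨ +-monoʳ-≤ k n+ρ≤R ⟩
      k + R                         ∎
      where
      open ≤-Reasoning
      cover : ∀ x → P x → x ∈ upTo k ++ L
      cover x Px with split x Px
      ... | inj₁ x<k = ∈-++⁺ˡ (∈-upTo⁺ x<k)
      ... | inj₂ Qx  = ∈-++⁺ʳ (upTo k) (Q⊆L x Qx)

    before : ∀ {k i} {B : Set} → (k ≤ i → B) → i < k ⊎ B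
    before {k} {i} f with i <? k
    ... | yes i<k = inj₁ i<k
    ... | no i≮k  = inj₂ (f (≮⇒≥ i≮k))

  confined : ∀ {t k ℓ} → Confined I R C t k ℓ → ∀ {i j} → k ≤ i → ℓ ≤ j → at t i j → A i j
  confined start _ _ x = x
  confined (advance path k≤k′ ℓ≤ℓ′ _) k′≤i ℓ′≤j (inj₁ x) =
    confined path (≤-trans k≤k′ k′≤i) (≤-trans ℓ≤ℓ′ ℓ′≤j) x
  confined {suc t} (advance {k = k} {ℓ = ℓ} path k≤k′ ℓ≤ℓ′ inside) {i} {j} k′≤i ℓ′≤j (inj₂ new)
    with find (inside k′≤i ℓ′≤j)
  ... | (a , b) , ab∈I , (a> , b>) with All.lookup new ab∈I
  ...   | inj₁ row = let _ , cov , le = rows j in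
          contradiction (count (λ i′ x → before λ k≤ → confined path k≤ (≤-trans ℓ≤ℓ′ ℓ′≤j) x) cov le row) (<⇒≱ a>)
  ...   | inj₂ col = let _ , cov , le = cols i in
          contradiction (count (λ j′ x → before λ ℓ≤ → confined path (≤-trans k≤k′ k′≤i) ℓ≤ x) cov le col) (<⇒≱ b>)

-- Eventually constant sets and filling times

record Stable (M : ℕ) (A : Subset²) : Set where
  field
    decide : ∀ i j → Dec (A i j)
    alongRow : ∀ {i i′ j} → M ≤ i → M ≤ i′ → A i j → A i′ j
    alongCol : ∀ {i j j′} → M ≤ j → M ≤ j′ → A i j → A i j′

VanishesFrom : ℕ → (ℕ → ℕ) → Set
VanishesFrom M r = ∀ n → M ≤ n → r n ≡ 0

-- Line `M` stands for all later lines in either direction, so the square up to and including `M`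
-- decides.
full? : ∀ {M A} → Stable M A → Dec (Full A)
full? {M} {A} S = map′ extend (λ full _ _ → full _ _) corner?
  where
  open Stable S
  corner? : Dec (∀ {i} → i < suc M → ∀ {j} → j < suc M → A i j)
  corner? = allUpTo? (λ i → allUpTo? (decide i) (suc M)) (suc M)

  extend : (∀ {i} → i < suc M → ∀ {j} → j < suc M → A i j) → Full A
  extend corner i j = inRow (inColumn ≤-refl)
    where
    inColumn : ∀ {i} → i ≤ M → A i j
    inColumn i≤M with ≤-total j M
    ... | inj₁ j≤M = corner (s≤s i≤M) (s≤s j≤M)
    ... | inj₂ M≤j = alongCol ≤-refl M≤j (corner (s≤s i≤M) ≤-refl)
    inRow : A M j → A i j
    inRow x with ≤-total i M
    ... | inj₁ i≤M = inColumn i≤M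
    ... | inj₂ M≤i = alongRow ≤-refl M≤i x

module _ {I : Points} {r c : ℕ → ℕ} {M : ℕ} (r₀ : VanishesFrom M r) (c₀ : VanishesFrom M c) where

  -- Two points far out in one row have the same enhancements, as `c` vanishes there, and their
  -- columns agree by stability of `A`.
  Ten-stable : ∀ {A} → Stable M A → Stable M (Ten I r c A)
  Ten-stable {A} S = record
    { decide = λ i j → decide i j ⊎-dec All.all? (λ ab →
        atLeast? (λ i′ → decide i′ j) M alongRow (proj₁ ab ∸ r j) ⊎-dec
        atLeast? (decide i) M alongCol (proj₂ ab ∸ c i)) I
    ; alongRow = λ {i} {i′} M≤i M≤i′ → Sum.map (alongRow M≤i M≤i′) (All.map λ {ab} → Sum.map id λ col →
        subst (λ n → AtLeast (proj₂ ab ∸ n) (A i′)) (trans (c₀ i M≤i) (sym (c₀ i′ M≤i′)))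
          (AtLeast-⊆ (λ j → alongRow {j = j} M≤i M≤i′) col))
    ; alongCol = λ {i} {j} {j′} M≤j M≤j′ → Sum.map (alongCol M≤j M≤j′) (All.map λ {ab} → Sum.map (λ row →
        subst (λ n → AtLeast (proj₁ ab ∸ n) (λ i′ → A i′ j′)) (trans (r₀ j M≤j) (sym (r₀ j′ M≤j′)))
          (AtLeast-⊆ (λ i → alongCol {i = i} M≤j M≤j′) row)) id)
    }
    where open Stable S

  iterate-stable : ∀ {A} → Stable M A → ∀ t → Stable M (iterate (Ten I r c) t A)
  iterate-stable S zero    = S
  iterate-stable S (suc t) = Ten-stable (iterate-stable S t)

FillingTime : (ℕ → Subset²) → ℕ → Set
FillingTime X t = 1 ≤ t × Full (X t) × (∀ u → 1 ≤ u → u < t → ¬ Full (X u))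

module _ {I : Points} {r c : ℕ → ℕ} {M : ℕ} (r₀ : VanishesFrom M r) (c₀ : VanishesFrom M c)
  {A : Subset²} (S : Stable M A) (boundedA : ∀ {i j} → A i j → i < M) where

  open Growth I r c A

  fillingTime> : ∀ {t₀ N k ℓ R C} → Full (at t₀) →
    (∀ j → Σ ℕ λ n → Coverable (λ i → A i j) n × n + r j ≤ R j) →
    (∀ i → Σ ℕ λ n → Coverable (A i) n × n + c i ≤ C i) →
    Confined I R C N k ℓ → Σ ℕ λ t → FillingTime at t × N < t
  fillingTime> {t₀} {N} {k} {ℓ} full rows cols path
    with least (λ t → (1 ≤? t) ×-dec full? (iterate-stable r₀ c₀ S t)) (suc t₀)
           (s≤s z≤n , λ i j → inj₁ (full i j))
  ... | t , (1≤t , full-t) , minimal =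
        t , (1≤t , full-t , λ u 1≤u u<t full-u → minimal u u<t (1≤u , full-u)) , ≰⇒> late
    where
    late : ¬ t ≤ N
    -- A full set would contain `(k ⊔ M , ℓ)`. Confinement puts this point into `A`, whose points
    -- have first coordinate below `M`.
    late t≤N = <⇒≱ (boundedA (confined rows cols path (m≤m⊔n k M) ≤-refl (at-mono t≤N (full-t (k ⊔ M) ℓ))))
                   (m≤n⊔m k M)

-- The path is confined for 1 ⊔ r and 1 ⊔ c because in the thin set every far column may hold one cell
-- that belongs to a row, and vice versa.
record SlowEnhancement (I : Points) (N : ℕ) : Set where
  field
    r c : ℕ → ℕ
    r-decreasing : WeaklyDecreasing r
    c-decreasing : WeaklyDecreasing c
    r-finite : FiniteSupport r
    c-finite : FiniteSupport c
    {time} : ℕ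
    fills : Full (iterate (Ten I r c) time ∅)
    {k ℓ} : ℕ
    path : Confined I (λ j → 1 ⊔ r j) (λ i → 1 ⊔ c i) N k ℓ

  M : ℕ
  M = proj₁ r-finite ⊔ proj₁ c-finite

  r-vanishes : VanishesFrom M r
  r-vanishes n M≤n = proj₂ r-finite n (≤-trans (m≤m⊔n _ _) M≤n)

  c-vanishes : VanishesFrom M c
  c-vanishes n M≤n = proj₂ c-finite n (≤-trans (m≤n⊔m (proj₁ r-finite) _) M≤n)

∅-stable : ∀ M → Stable M ∅
∅-stable M = record { decide = λ _ _ → no λ () ; alongRow = λ _ _ () ; alongCol = λ _ _ () }

module _ {I : Points} {N : ℕ} (E : SlowEnhancement I N) where
  open SlowEnhancement E

  slow-enhanced : Σ ℕ λ t → TauEn I r c t × N < t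
  slow-enhanced = fillingTime> r-vanishes c-vanishes (∅-stable M) (λ ()) {t₀ = time} fills
    (λ j → 0 , ([] , (λ _ ()) , z≤n) , m≤n⊔m 1 (r j))
    (λ i → 0 , ([] , (λ _ ()) , z≤n) , m≤n⊔m 1 (c i))
    path

-- Thin sets

module Arms (M W : ℕ) .{{_ : NonZero W}} where

  -- Row j has the f j private columns M + (n + j * W).
  slot : ℕ → ℕ → ℕ
  slot j n = M + (n + j * W)

  Arm : (ℕ → ℕ) → Subset²
  Arm f i j = Σ ℕ λ n → n < f j × i ≡ slot j n

  arm? : ∀ f i j → Dec (Arm f i j)
  arm? f i j = anyUpTo? (λ n → i ≟ slot j n) (f j)

  slot-beyond : ∀ j n → M ≤ slot j n
  slot-beyond j n = m≤m+n M _

  owner : ℕ → ℕ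
  owner i = (i ∸ M) / W

  owner-slot : ∀ j {n} → n < W → owner (slot j n) ≡ j
  owner-slot j {n} n<W = begin
    (M + (n + j * W) ∸ M) / W   ≡⟨ cong (_/ W) (m+n∸m≡n M _) ⟩
    (n + j * W) / W             ≡⟨ +-distrib-/-∣ʳ n (n∣m*n j) ⟩
    n / W + j * W / W           ≡⟨ cong₂ _+_ (m<n⇒m/n≡0 n<W) (m*n/n≡m j W) ⟩
    j                           ∎
    where open ≡-Reasoning

  slot-injective : ∀ j {n n′} → slot j n ≡ slot j n′ → n ≡ n′
  slot-injective j eq = +-cancelʳ-≡ (j * W) _ _ (+-cancelˡ-≡ M _ _ eq)

  bound : ℕ
  bound = M + (W + M * W)

  module _ {f : ℕ → ℕ} (f₀ : VanishesFrom M f) (f<W : ∀ n → f n < W) where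

    arm-base : ∀ {i j} → Arm f i j → j < M
    arm-base {j = j} (n , n<fj , _) = ≰⇒> λ M≤j → n≮0 (subst (n <_) (f₀ j M≤j) n<fj)

    arm-beyond : ∀ {i j} → Arm f i j → M ≤ i
    arm-beyond {j = j} (n , _ , refl) = slot-beyond j n

    arm-owner : ∀ {i j} → Arm f i j → owner i ≡ j
    arm-owner {j = j} (n , n<fj , refl) = owner-slot j (<-trans n<fj (f<W j))

    arm-bounded : ∀ {i j} → Arm f i j → i < bound × j < bound
    arm-bounded {j = j} arm@(n , n<fj , refl) =
        +-monoʳ-< M (+-mono-<-≤ (<-trans n<fj (f<W j)) (*-monoˡ-≤ W (<⇒≤ (arm-base arm))))
      , <-≤-trans (arm-base arm) (m≤m+n M _)

    arm-length : ∀ j → Coverable (λ i → Arm f i j) (f j)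
    arm-length j = map (slot j) (upTo (f j))
      , (λ { i (n , n<fj , refl) → ∈-map⁺ (slot j) (∈-upTo⁺ n<fj) })
      , ≤-reflexive (trans (length-map (slot j) (upTo (f j))) (length-upTo (f j)))

  -- Arms are based below `M` and occupy private lines beyond `M`. So a line below `M` meets only
  -- its own arm, and a line beyond `M` at most one cell, that of its owner.
  cross-cover : ∀ {f g} → VanishesFrom M f → (∀ n → f n < W) → VanishesFrom M g → (∀ n → g n < W) →
    ∀ j → Coverable (λ i → Arm f i j ⊎ Arm g j i) (1 ⊔ f j)
  cross-cover {f} {g} f₀ f<W g₀ g<W j with j <? M
  ... | yes j<M = let L , f⊆L , |L|≤ = arm-length f₀ f<W j in
        L , (λ i → [ f⊆L i , (λ arm → contradiction (arm-beyond g₀ g<W arm) (<⇒≱ j<M)) ]′)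
          , ≤-trans |L|≤ (m≤n⊔m 1 (f j))
  ... | no j≮M = owner j ∷ []
      , (λ i → [ (λ arm → contradiction (arm-base f₀ f<W arm) j≮M) , (λ arm → here (sym (arm-owner g₀ g<W arm))) ]′)
      , m≤m⊔n 1 (f j)

  -- If `P` reaches beyond `M`, it is infinite. Otherwise the given members lie below `M`, disjoint
  -- from the arm, whose `f j` cells make up for the enhancement.
  with-arm : ∀ {P Q : ℕ → Set} {f j a} → (∀ {x y} → M ≤ x → M ≤ y → P x → P y) →
    (∀ x → P x → Q x) → (∀ i → Arm f i j → Q i) → AtLeast (a ∸ f j) P → AtLeast a Q
  with-arm {P} {Q} {f} {j} {a} tail P⊆Q arm⊆Q many@(h , h-inj , Ph) with any? (λ k → M ≤? h k)
  ... | yes (k , M≤hk) = AtLeast-tail M a λ x M≤x → P⊆Q x (tail M≤hk M≤x (Ph k))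
  ... | no ¬beyond = AtLeast-≤ Q (subst (a ≤_) (+-comm (f j) _) (m≤n+m∸n a (f j)))
        (AtLeast-+ {P = λ x → P x × x < M} {Q = λ i → Arm f i j} (λ x → P⊆Q x ∘ proj₁) arm⊆Q
          (λ { _ (_ , x<M) (n , _ , refl) → <⇒≱ x<M (slot-beyond j n) })
          (h , h-inj , λ k → Ph k , ≰⇒> (λ M≤hk → ¬beyond (k , M≤hk)))
          ( slot j ∘ toℕ
          , (λ eq → toℕ-injective (slot-injective j eq))
          , λ k → toℕ k , toℕ<n k , refl))

-- Regular dynamics as enhanced dynamics with zero enhancements

module _ {I : Points} {X : Subset²} (X? : ∀ t i j → Dec (iterate (Ten I (λ _ → 0) (λ _ → 0)) t X i j)) where

  -- `T` adds a point only if it is absent, while `Ten` has no such proviso. Deciding each iterate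
  -- closes the gap, and the first direction transports absence for the second.
  T⇒Ten : ∀ t {i j} → iterate (T I) t X i j → iterate (Ten I (λ _ → 0) (λ _ → 0)) t X i j
  Ten⇒T : ∀ t {i j} → iterate (Ten I (λ _ → 0) (λ _ → 0)) t X i j → iterate (T I) t X i j
  T⇒Ten zero    x = x
  T⇒Ten (suc t) (inj₁ x) = inj₁ (T⇒Ten t x)
  T⇒Ten (suc t) (inj₂ (_ , new)) =
    inj₂ (All.map (Sum.map (AtLeast-⊆ λ i → T⇒Ten t {i}) (AtLeast-⊆ λ j → T⇒Ten t {j = j})) new)
  Ten⇒T zero    x = x
  Ten⇒T (suc t) (inj₁ x) = inj₁ (Ten⇒T t x)
  Ten⇒T (suc t) {i} {j} (inj₂ new) with X? t i j
  ... | yes x = inj₁ (Ten⇒T t x)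
  ... | no ¬x = inj₂ (¬x ∘ T⇒Ten t , All.map (Sum.map (AtLeast-⊆ λ i → Ten⇒T t {i}) (AtLeast-⊆ λ j → Ten⇒T t {j = j})) new)

module _ {I : Points} {N : ℕ} (E : SlowEnhancement I N) where
  open SlowEnhancement E

  private
    W : ℕ
    W = suc (r 0 + c 0)

    r<W : ∀ n → r n < W
    r<W n = s≤s (≤-trans (r-decreasing 0 n z≤n) (m≤m+n (r 0) (c 0)))

    c<W : ∀ n → c n < W
    c<W n = s≤s (≤-trans (c-decreasing 0 n z≤n) (m≤n+m (c 0) (r 0)))

    open Arms M W

    Cell : Subset²
    Cell i j = Arm r i j ⊎ Arm c j i

    cell? : ∀ (ij : ℕ × ℕ) → Dec (Cell (proj₁ ij) (proj₂ ij))
    cell? (i , j) = arm? r i j ⊎-dec arm? c j i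

    cell-bounded : ∀ {i j} → Cell i j → i < bound × j < bound
    cell-bounded = [ arm-bounded r-vanishes r<W , swap ∘ arm-bounded c-vanishes c<W ]′

    cells : List (ℕ × ℕ)
    cells = filter cell? (cartesianProduct (upTo bound) (upTo bound))

    ∈⇒cell : ∀ {i j} → (i , j) ∈ cells → Cell i j
    ∈⇒cell = proj₂ ∘ ∈-filter⁻ cell? {xs = cartesianProduct (upTo bound) (upTo bound)}

    cell⇒∈ : ∀ {i j} → Cell i j → (i , j) ∈ cells
    cell⇒∈ x = let i< , j< = cell-bounded x in
      ∈-filter⁺ cell? (∈-cartesianProduct⁺ (∈-upTo⁺ i<) (∈-upTo⁺ j<)) x

    -- A cell of a horizontal arm is alone in its column: that column has one owner, and vertical
    -- arms stay in columns below `M`. The other case is symmetric.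
    cells-thin : Thin cells
    cells-thin (i , j) x with ∈⇒cell x
    ... | inj₁ arm = inj₂ λ { (_ , j′) y refl → cong (i ,_)
            ([ (λ arm′ → trans (sym (arm-owner r-vanishes r<W arm′)) (arm-owner r-vanishes r<W arm))
             , (λ arm′ → contradiction (arm-base c-vanishes c<W arm′) (≤⇒≯ (arm-beyond r-vanishes r<W arm))) ]′
             (∈⇒cell y)) }
    ... | inj₂ arm = inj₁ λ { (i′ , _) y refl → cong (_, j)
            ([ (λ arm′ → contradiction (arm-base r-vanishes r<W arm′) (≤⇒≯ (arm-beyond c-vanishes c<W arm)))
             , (λ arm′ → trans (sym (arm-owner c-vanishes c<W arm′)) (arm-owner c-vanishes c<W arm)) ]′
             (∈⇒cell y)) }

    cells-stable : Stable bound ⟦ cells ⟧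
    cells-stable = record
      { decide = λ i j → map′ cell⇒∈ ∈⇒cell (cell? (i , j))
      ; alongRow = λ b≤i _ x → contradiction (proj₁ (cell-bounded (∈⇒cell x))) (≤⇒≯ b≤i)
      ; alongCol = λ b≤j _ x → contradiction (proj₂ (cell-bounded (∈⇒cell x))) (≤⇒≯ b≤j)
      }

    none : ℕ → ℕ
    none _ = 0

    module Enh = Growth I r c ∅
    module Reg = Growth I none none ⟦ cells ⟧

    -- The arm cells, present from time 0, supply the counts that the enhancements contribute.
    enhanced⊆regular : ∀ t {i j} → Enh.at t i j → Reg.at t i j
    enhanced⊆regular (suc t) (inj₁ x) = inj₁ (enhanced⊆regular t x)
    enhanced⊆regular (suc t) {i} {j} (inj₂ new) = inj₂ (All.map (Sum.map
        (with-arm {f = r} alongRow (λ _ → enhanced⊆regular t)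
          (λ _ arm → Reg.at-mono {u = t} z≤n (cell⇒∈ (inj₁ arm))))
        (with-arm {f = c} alongCol (λ _ → enhanced⊆regular t)
          (λ _ arm → Reg.at-mono {u = t} z≤n (cell⇒∈ (inj₂ arm))))) new)
      where open Stable (iterate-stable {I = I} r-vanishes c-vanishes (∅-stable M) t)

    cover-⊆ : ∀ {P Q : ℕ → Set} {n m} → (∀ x → P x → Q x) → Coverable Q n → n ≤ m →
      Σ ℕ λ n → Coverable P n × n + 0 ≤ m
    cover-⊆ {n = n} P⊆Q (L , Q⊆L , len) n≤m =
      n , (L , (λ x → Q⊆L x ∘ P⊆Q x) , len) , ≤-trans (≤-reflexive (+-identityʳ n)) n≤m

    regular? : ∀ t i j → Dec (Reg.at t i j)
    regular? t = Stable.decide (iterate-stable {I = I} {M = bound} (λ _ _ → refl) (λ _ _ → refl) cells-stable t)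

  slow-thin : Σ (List (ℕ × ℕ)) λ A → Thin A × Spans I A × Σ ℕ λ t → Tau I A t × N < t
  slow-thin with fillingTime> {I = I} {M = bound} (λ _ _ → refl) (λ _ _ → refl) cells-stable
      (proj₁ ∘ cell-bounded ∘ ∈⇒cell) {t₀ = time} (λ i j → enhanced⊆regular time (fills i j))
      (λ j → cover-⊆ (λ _ → ∈⇒cell) (cross-cover r-vanishes r<W c-vanishes c<W j) ≤-refl)
      (λ i → cover-⊆ (λ _ → Sum.swap ∘ ∈⇒cell) (cross-cover c-vanishes c<W r-vanishes r<W i) ≤-refl)
      path
  ... | t , (1≤t , full , minimal) , N<t =
      cells , cells-thin , (λ i j → t , Ten⇒T regular? t (full i j))
    , t , (1≤t , (λ i j → Ten⇒T regular? t (full i j))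
              , λ u 1≤u u<t full-u → minimal u 1≤u u<t λ i j → T⇒Ten regular? u (full-u i j)) , N<t

Bound : Points → ℕ → Set
Bound I B = ∀ {p q} → InZ I p q → p < B × q < B

-- Staircases

module Staircase (I : Points) (B : ℕ) (inB : Bound I B) where

  a : ℕ → ℕ
  a = rowLength I

  a≤B : ∀ q → a q ≤ B
  a≤B q = ≤-from-< (proj₁ ∘ inB ∘ <rowLength⇒inZ I)

  a-vanishes : VanishesFrom B a
  a-vanishes q B≤q = n≤0⇒n≡0 (≤-from-< λ p< → contradiction (proj₂ (inB (<rowLength⇒inZ I p<))) (≤⇒≯ B≤q))

  -- `c` is cut off at `B` for finite support; the remaining cells of a row are added once `B` of
  -- its cells are occupied.
  r c : ℕ → ℕ
  r j = a (suc j)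
  c i = 1 ⊓ (B ∸ i)

  open Growth I r c ∅

  -- Once the rows below `j` are full, a cell `(i , j)` with `i < B` has enhanced counts at least
  -- `a (j + 1)` and `j + 1`, a pair outside `Z`. A second step completes the row, since `B` cells
  -- alone leave `Z`.
  rowsFill : ∀ j → Σ ℕ λ τ → ∀ i j′ → j′ < j → at τ i j′
  rowsFill zero = 0 , λ _ _ ()
  rowsFill (suc j) with rowsFill j
  ... | τ , below = 2 + τ , λ i j′ j′<1+j → [ (λ j′<j → at-mono {τ} (m≤n+m τ 2) (below i j′ j′<j)) , (λ { refl → row i }) ]′
                      (m≤n⇒m<n∨m≡n (s≤s⁻¹ j′<1+j))
    where
    initial : ∀ i → i < B → at (suc τ) i j
    initial i i<B = fill τ 0 j (λ _ ()) (below i) λ z → <-irrefl refl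
      (subst (λ n → a (suc j) < a n) (trans (cong (j +_) (m≤n⇒m⊓n≡m (m<n⇒0<n∸m i<B))) (+-comm j 1)) (inZ⇒<rowLength I z))
    row : ∀ i → at (2 + τ) i j
    row i = fill (suc τ) B 0 initial (λ _ ()) λ z → <⇒≱ (proj₁ (inB z)) (m≤m+n B _)

  time : ℕ
  time = suc (proj₁ (rowsFill B))

  fills : Full (at time)
  fills i j = fill (proj₁ (rowsFill B)) 0 B (λ _ ()) (proj₂ (rowsFill B) i) λ z → <⇒≱ (proj₂ (inB z)) (m≤m+n B _)

  -- With `k = 0` confinement concerns whole rows: those from `ℓ` on have gained nothing.
  Path : ℕ → ℕ → Set
  Path n ℓ = Confined I (λ j → 1 ⊔ r j) (λ i → 1 ⊔ c i) n 0 ℓ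

  -- While only rows below `pred y` have grown, a point of row `j` has column count at most
  -- `pred y + 1 = y` and row count at most `1 ⊔ a (suc j)`, enhancements included. For `j` from `ℓ`
  -- on the latter is less than `a y`, so the pair lies in `Z`.
  descend : ∀ {n y ℓ} → Path n (pred y) → 1 ≤ y → pred y ≤ ℓ → 1 < a y → (∀ j → ℓ ≤ j → a (suc j) < a y) → Path (suc n) ℓ
  descend {y = y@(suc _)} path _ y≤ℓ 1<ay drop = advance path z≤n y≤ℓ λ {i} {j} _ ℓ≤j →
    inZ-↓ ≤-refl (≤-trans (+-monoʳ-≤ (pred y) (⊔-lub ≤-refl (m⊓n≤m 1 (B ∸ i)))) (≤-reflexive (+-comm (pred y) 1)))
      (<rowLength⇒inZ I (⊔-lub 1<ay (drop j ℓ≤j)))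

  next : ∀ {n y y′} → Path n (pred y) → 1 ≤ y → y < y′ → 1 < a y → a y′ < a y → Path (suc n) (pred y′)
  next {y′ = suc _} path 1≤y y<y′ 1<ay drop =
    descend path 1≤y (≤-trans pred[n]≤n (s≤s⁻¹ y<y′)) 1<ay λ j y′≤j → ≤-<-trans (rowLength-antitone I (s≤s y′≤j)) drop

  last : ∀ {n y} → Path n (pred y) → 1 ≤ y → 1 < a y → Path (suc n) B
  last {y = y} path 1≤y 1<ay =
    descend path 1≤y (≤-trans pred[n]≤n (<⇒≤ (proj₂ (inB (<rowLength⇒inZ I 1<ay))))) 1<ay
      λ j B≤j → subst (_< a y) (sym (a-vanishes (suc j) (m≤n⇒m≤1+n B≤j))) (<-trans z<s 1<ay)

  staircase : ∀ {N} → Path N B → SlowEnhancement I N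
  staircase path = record
    { r = r ; c = c
    ; r-decreasing = λ m n m≤n → rowLength-antitone I (s≤s m≤n)
    ; c-decreasing = λ m n m≤n → ⊓-monoʳ-≤ 1 (∸-monoʳ-≤ B m≤n)
    ; r-finite = B , λ n B≤n → a-vanishes (suc n) (m≤n⇒m≤1+n B≤n)
    ; c-finite = B , λ n B≤n → cong (1 ⊓_) (m≤n⇒m∸n≡0 B≤n)
    ; time = time ; fills = fills
    ; path = path
    }

-- Peaks

record Peak (I : Points) (T : ℕ) : Set where
  field
    {x₀ y₀} : ℕ
    inside : InZ I (x₀ + T) (y₀ + T)
    maximal : ∀ {p q} → InZ I p q → x₀ ≤ p → y₀ ≤ q → p + q ≤ (x₀ + T) + (y₀ + T)

module Ramp (T B : ℕ) where

  -- The second summand vanishes from `z` on. Before `z` it is at least `B`, so those lines fill at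
  -- once.
  ramp : ℕ → ℕ → ℕ
  ramp z n = (suc T ∸ (n ∸ z)) + B * (z ∸ n)

  ramp-decreasing : ∀ z → WeaklyDecreasing (ramp z)
  ramp-decreasing z m n m≤n =
    +-mono-≤ (∸-monoʳ-≤ (suc T) (∸-monoˡ-≤ z m≤n)) (*-monoʳ-≤ B (∸-monoʳ-≤ z m≤n))

  ramp-at : ∀ z n → ramp z (z + n) ≡ suc T ∸ n
  ramp-at z n rewrite m+n∸m≡n z n | m≤n⇒m∸n≡0 (m≤m+n z n) | *-zeroʳ B = +-identityʳ _

  ramp-after : ∀ {z m} n → z + n ≤ m → ramp z m ≤ suc T ∸ n
  ramp-after {z} {m} n z+n≤m = ≤-trans (ramp-decreasing z _ _ z+n≤m) (≤-reflexive (ramp-at z n))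

  ramp-before : ∀ {z n} → n < z → B ≤ ramp z n
  ramp-before {z} {n} n<z = m≤n⇒m≤o+n _ (≤-trans (≤-reflexive (sym (*-identityʳ B))) (*-monoʳ-≤ B (m<n⇒0<n∸m n<z)))

  ramp-finite : ∀ z → FiniteSupport (ramp z)
  ramp-finite z = z + suc T , λ n z+1+T≤n → n≤0⇒n≡0 (≤-trans (ramp-after (suc T) z+1+T≤n) (≤-reflexive (n∸n≡0 T)))

-- P τ u says that the u-th cell of a line is occupied at time τ; X + (suc T ∸ t) and y₀ + t + γ u are the counts
-- along and across the line at that cell, enhancements included.
lineFills : ∀ {T x₀ y₀ t} {γ : ℕ → ℕ} {P : ℕ → ℕ → Set} → t ≤ suc T →
  (∀ {τ u} → P τ u → P (suc τ) u) →
  (∀ {τ} X u → (∀ u′ → u′ < X → P τ u′) → x₀ ≤ X →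
    x₀ + T + (y₀ + T) < (X + (suc T ∸ t)) + (y₀ + t + γ u) → P (suc τ) u) →
  (∀ n → suc T ∸ n ≤ γ (x₀ + n)) →
  (∀ u → u < x₀ + t → P 0 u) → Σ ℕ λ τ → ∀ u → P τ u
lineFills {T} {x₀} {y₀} {t} {γ} {P} t≤ later step γ≥ initial = suc d , λ u →
  -- After `d` steps the first `x₀ + suc T` cells are occupied, which suffices for every further
  -- cell even with 0 in place of `γ u`.
  step (x₀ + (t + d)) u (segment d) (m≤m+n x₀ _)
    (≤-trans (enough d {0} (≤-reflexive (n∸n≡0 d))) (+-monoʳ-≤ (x₀ + (t + d) + d) (+-monoʳ-≤ (y₀ + t) z≤n)))
  where
  d = suc T ∸ t
  t+d : t + d ≡ suc T
  t+d = m+[n∸m]≡n t≤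

  -- The `m` cells gained along the line offset the drop of the guaranteed `γ` from `d` to `d ∸ m`,
  -- so the sum stays at least two above that of the peak.
  enough : ∀ m {g} → d ∸ m ≤ g → x₀ + T + (y₀ + T) < (x₀ + (t + m) + d) + (y₀ + t + g)
  enough m {g} d∸m≤g = begin-strict
    x₀ + T + (y₀ + T)                   <⟨ n<1+n _ ⟩
    suc (x₀ + T + (y₀ + T))             <⟨ n<1+n _ ⟩
    suc (suc (x₀ + T + (y₀ + T)))       ≡⟨ (λ x y T → lemma₁ x y T) x₀ y₀ T ⟩
    x₀ + suc T + (y₀ + suc T)           ≡⟨ cong (λ n → x₀ + n + (y₀ + n)) (sym t+d) ⟩
    x₀ + (t + d) + (y₀ + (t + d))       ≤⟨ +-monoʳ-≤ (x₀ + (t + d)) (+-monoʳ-≤ y₀ (+-monoʳ-≤ t (m≤n+m∸n d m))) ⟩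
    x₀ + (t + d) + (y₀ + (t + (m + (d ∸ m)))) ≤⟨ +-monoʳ-≤ (x₀ + (t + d)) (+-monoʳ-≤ y₀ (+-monoʳ-≤ t (+-monoʳ-≤ m d∸m≤g))) ⟩
    x₀ + (t + d) + (y₀ + (t + (m + g))) ≡⟨ lemma₂ x₀ y₀ t d m g ⟩
    (x₀ + (t + m) + d) + (y₀ + t + g)   ∎
    where
    open ≤-Reasoning
    lemma₁ : ∀ x y T → suc (suc (x + T + (y + T))) ≡ x + suc T + (y + suc T)
    lemma₁ = solve-∀
    lemma₂ : ∀ x y t d m g → x + (t + d) + (y + (t + (m + g))) ≡ (x + (t + m) + d) + (y + t + g)
    lemma₂ = solve-∀

  segment : ∀ m u → u < x₀ + (t + m) → P m u
  segment zero u u< = initial u (subst (u <_) (cong (x₀ +_) (+-identityʳ t)) u<)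
  segment (suc m) u u< with m≤n⇒m<n∨m≡n (s≤s⁻¹ (subst (u <_) (trans (cong (x₀ +_) (+-suc t m)) (+-suc x₀ (t + m))) u<))
  ... | inj₁ u<′ = later (segment m u u<′)
  ... | inj₂ refl = step (x₀ + (t + m)) u (segment m) (m≤m+n x₀ _)
        (enough m (≤-trans (≤-reflexive (∸-+-assoc (suc T) t m)) (γ≥ (t + m))))

module AtPeak {I : Points} {T B : ℕ} (inB : Bound I B) (peak : Peak I T) where
  open Peak peak
  open Ramp T B

  r c : ℕ → ℕ
  r = ramp y₀
  c = ramp x₀

  open Growth I r c ∅

  beyond : ∀ {p q} → x₀ ≤ p → y₀ ≤ q → (x₀ + T) + (y₀ + T) < p + q → ¬ InZ I p q
  beyond x₀≤p y₀≤q sum z = <⇒≱ sum (maximal z x₀≤p y₀≤q)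

  Crossed : ℕ → ℕ → Set
  Crossed τ t = (∀ i j → i < x₀ + t → at τ i j) × (∀ i j → j < y₀ + t → at τ i j)

  -- At first the enhancements before `x₀` and `y₀` alone leave `Z`. Then row `y₀ + t` and column
  -- `x₀ + t` fill independently from time `τ`, and the sum of the two durations is enough for both.
  crosses : ∀ t → t ≤ suc T → Σ ℕ λ τ → Crossed τ t
  crosses zero _ = 1
    , (λ i j i<x₀ → fill 0 0 0 (λ _ ()) (λ _ ()) λ z →
        <⇒≱ (proj₂ (inB z)) (ramp-before (subst (i <_) (+-identityʳ x₀) i<x₀)))
    , (λ i j j<y₀ → fill 0 0 0 (λ _ ()) (λ _ ()) λ z →
        <⇒≱ (proj₁ (inB z)) (ramp-before (subst (j <_) (+-identityʳ y₀) j<y₀)))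
  crosses (suc t) t<1+T with crosses t (<⇒≤ t<1+T)
  ... | τ , columns , rows = ρ + κ + τ
      , (λ i j → extend (λ i< → at-mono later (columns i j i<)) (λ { refl → at-mono κ-later (column j) }))
      , (λ i j → extend (λ j< → at-mono later (rows i j j<)) (λ { refl → at-mono ρ-later (row i) }))
    where
    t≤1+T = <⇒≤ t<1+T

    extend : ∀ {z n} {Q : Set} → (n < z + t → Q) → (n ≡ z + t → Q) → n < z + suc t → Q
    extend {z} {n} old new n< = [ old , new ]′ (m≤n⇒m<n∨m≡n (s≤s⁻¹ (subst (n <_) (+-suc z t) n<)))

    r≥ : ∀ n → suc T ∸ n ≤ r (y₀ + n)
    r≥ n = ≤-reflexive (sym (ramp-at y₀ n))
    c≥ : ∀ n → suc T ∸ n ≤ c (x₀ + n)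
    c≥ n = ≤-reflexive (sym (ramp-at x₀ n))

    rowFills : Σ ℕ λ τ′ → ∀ i → at (τ′ + τ) i (y₀ + t)
    rowFills = lineFills {T} {x₀ = x₀} {y₀} {t} {c} {λ τ′ i → at (τ′ + τ) i (y₀ + t)} t≤1+T inj₁
      (λ {τ′} X i filled x₀≤X sum → fill (τ′ + τ) X (y₀ + t) filled
        (λ j j< → at-mono (m≤n+m τ τ′) (rows i j j<))
        (beyond (m≤n⇒m≤n+o _ x₀≤X) (≤-trans (m≤m+n y₀ t) (m≤m+n _ _))
          (<-≤-trans sum (+-monoˡ-≤ _ (+-monoʳ-≤ X (r≥ t))))))
      c≥ (λ i i< → columns i _ i<)

    columnFills : Σ ℕ λ τ′ → ∀ j → at (τ′ + τ) (x₀ + t) j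
    columnFills = lineFills {T} {x₀ = y₀} {x₀} {t} {r} {λ τ′ j → at (τ′ + τ) (x₀ + t) j} t≤1+T inj₁
      (λ {τ′} Y j filled y₀≤Y sum → fill (τ′ + τ) (x₀ + t) Y
        (λ i i< → at-mono (m≤n+m τ τ′) (columns i j i<)) filled
        (beyond (≤-trans (m≤m+n x₀ t) (m≤m+n _ _)) (m≤n⇒m≤n+o _ y₀≤Y)
          (subst₂ _<_ (+-comm (y₀ + T) _) (+-comm (Y + c (x₀ + t)) _)
            (<-≤-trans sum (+-monoˡ-≤ _ (+-monoʳ-≤ Y (c≥ t)))))))
      r≥ (λ j j< → rows _ j j<)

    ρ = proj₁ rowFills
    κ = proj₁ columnFills
    row = proj₂ rowFills
    column = proj₂ columnFills

    later : τ ≤ ρ + κ + τ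
    later = m≤n+m τ _
    ρ-later : ρ + τ ≤ ρ + κ + τ
    ρ-later = +-monoˡ-≤ τ (m≤m+n ρ κ)
    κ-later : κ + τ ≤ ρ + κ + τ
    κ-later = +-monoˡ-≤ τ (m≤n+m κ ρ)

  fills : Σ ℕ λ τ → Full (at τ)
  fills with crosses (suc T) ≤-refl
  ... | τ , columns , rows = suc τ , λ i j →
    fill τ (x₀ + suc T) (y₀ + suc T) (λ i′ → columns i′ j) (rows i)
      (beyond (≤-trans (m≤m+n x₀ _) (m≤m+n _ _)) (≤-trans (m≤m+n y₀ _) (m≤m+n _ _))
        (+-mono-<-≤ (<-≤-trans (+-monoʳ-< x₀ (n<1+n T)) (m≤m+n _ _))
                    (≤-trans (+-monoʳ-≤ y₀ (n≤1+n T)) (m≤m+n _ _))))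

  -- Past the first `x₀ + suc t` columns and `y₀ + suc t` rows both ramps are at most `T ∸ t`, which
  -- is positive for `t < T`. Added to the `x₀ + t` columns or `y₀ + t` rows already conceded, they
  -- do not exceed the coordinates of the peak.
  path : ∀ t → t ≤ T → Confined I (λ j → 1 ⊔ r j) (λ i → 1 ⊔ c i) t (x₀ + t) (y₀ + t)
  path zero _ = start
  path (suc t) t<T = advance (path t (<⇒≤ t<T)) (+-monoʳ-≤ x₀ (n≤1+n t)) (+-monoʳ-≤ y₀ (n≤1+n t))
    λ i≥ j≥ → inZ-↓ (bound x₀ j≥) (bound y₀ i≥) inside
    where
    bound : ∀ z {z′ n} → z′ + suc t ≤ n → z + t + (1 ⊔ ramp z′ n) ≤ z + T
    bound z {z′} n≥ = ≤-trans
      (+-monoʳ-≤ (z + t) (⊔-lub (m<n⇒0<n∸m t<T) (ramp-after {z = z′} (suc t) n≥)))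
      (≤-reflexive (trans (+-assoc z t (T ∸ t)) (cong (z +_) (m+[n∸m]≡n (<⇒≤ t<T)))))

  slow : SlowEnhancement I T
  slow = record
    { r = r ; c = c
    ; r-decreasing = ramp-decreasing y₀ ; c-decreasing = ramp-decreasing x₀
    ; r-finite = ramp-finite y₀ ; c-finite = ramp-finite x₀
    ; time = proj₁ fills ; fills = proj₂ fills ; path = path T ≤-refl
    }

-- Local search

<-of-sums : ∀ {x x′ u u′} → x + u < x′ + u′ → u′ ≤ u → x < x′
<-of-sums {x} {x′} {u} {u′} sum u′≤u = ≰⇒> λ x′≤x → <⇒≱ sum (+-mono-≤ x′≤x u′≤u)

module Search (I : Points) (B : ℕ) (inB : Bound I B) (T s : ℕ) (1≤T : 1 ≤ T) where
  open Staircase I B inB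

  -- One more than the coordinate sum at the end of a nonempty row.
  height : ℕ → ℕ
  height y = a y + y

  Outcome : Set
  Outcome = Peak I T ⊎ Σ ℕ λ N → s ≤ suc N * T × Path N B

  -- The visited rows of record low height give a path ending with the initial row, those of record short
  -- length a path beginning with it; each record improves on the previous one by at most T.
  record Lowest (y : ℕ) : Set where
    field
      {row steps} : ℕ
      T≤row : T ≤ row
      T<a-row : T < a row
      row≤y : row ≤ y
      height≤ : height row ≤ height y
      many : s + T ≤ suc row + steps * T
      fromRow : ∀ {n} → Path n (pred row) → Path (steps + n) B

  record Shortest (y : ℕ) : Set where
    field
      {row steps} : ℕ
      T≤row : T ≤ row
      T<a-row : T < a row
      a-row≤a : a row ≤ a y
      height≤ : height row ≤ height y
      many : s ≤ a row + steps * T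
      toRow : Path steps (pred row)

  Better : ℕ → ℕ → Set
  Better y y′ = y ≤ y′ + T × a y ≤ a y′ + T × height y < height y′

  better? : ∀ y y′ → Dec (Better y y′)
  better? y y′ = (y ≤? y′ + T) ×-dec (a y ≤? a y′ + T) ×-dec (height y <? height y′)

  open ≤-Reasoning hiding (start)

  -- A row of smaller index but greater height is longer, as `next` demands for a step from it to
  -- the old record. The old record is at most `y`, so the index drops by at most `T`.
  lower : ∀ {y y′} → Lowest y → Better y y′ → T ≤ y′ → T < a y′ → Lowest y′
  lower {y} {y′} low (y≤ , _ , better) T≤y′ T<ay′ = case (row ≤? y′)
    where
    open Lowest low
    better′ : height row < height y′
    better′ = ≤-<-trans height≤ better

    case : Dec (row ≤ y′) → Lowest y′
    case (yes row≤y′) = record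
      { T≤row = T≤row ; T<a-row = T<a-row ; row≤y = row≤y′ ; height≤ = <⇒≤ better′
      ; many = many ; fromRow = fromRow }
    case (no row≰y′) = record
      { T≤row = T≤y′ ; T<a-row = T<ay′ ; row≤y = ≤-refl ; height≤ = ≤-refl
      ; many = begin
          s + T                          ≤⟨ many ⟩
          suc row + steps * T            ≤⟨ +-monoˡ-≤ (steps * T) (s≤s (≤-trans row≤y y≤)) ⟩
          suc y′ + T + steps * T         ≡⟨ +-assoc (suc y′) T (steps * T) ⟩
          suc y′ + suc steps * T         ∎
      ; fromRow = λ {n} path → subst (λ m → Path m B) (+-suc steps n)
          (fromRow (next path (≤-trans 1≤T T≤y′) (≰⇒> row≰y′) (≤-<-trans 1≤T T<ay′)
            (<-of-sums better′ (<⇒≤ (≰⇒> row≰y′)))))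
      }

  -- A shorter row of greater height has the larger index, so it extends the path at its end.
  shorten : ∀ {y y′} → Shortest y → Better y y′ → T ≤ y′ → T < a y′ → Shortest y′
  shorten {y} {y′} short (_ , a≤ , better) T≤y′ T<ay′ = case (a row ≤? a y′)
    where
    open Shortest short
    better′ : height row < height y′
    better′ = ≤-<-trans height≤ better

    case : Dec (a row ≤ a y′) → Shortest y′
    case (yes a≤a′) = record
      { T≤row = T≤row ; T<a-row = T<a-row ; a-row≤a = a≤a′ ; height≤ = <⇒≤ better′
      ; many = many ; toRow = toRow }
    case (no a≰a′) = record
      { T≤row = T≤y′ ; T<a-row = T<ay′ ; a-row≤a = ≤-refl ; height≤ = ≤-refl
      ; many = begin
          s                              ≤⟨ many ⟩
          a row + steps * T              ≤⟨ +-monoˡ-≤ (steps * T) (≤-trans a-row≤a a≤) ⟩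
          a y′ + T + steps * T           ≡⟨ +-assoc (a y′) T (steps * T) ⟩
          a y′ + suc steps * T           ∎
      ; toRow = next toRow (≤-trans 1≤T T≤row)
          (<-of-sums (subst₂ _<_ (+-comm (a row) row) (+-comm (a y′) y′) better′) (<⇒≤ (≰⇒> a≰a′)))
          (≤-<-trans 1≤T T<a-row) (≰⇒> a≰a′)
      }

  -- Heights increase strictly and stay below `B + B`, which bounds the number of moves.
  climb : ∀ fuel {y} → T ≤ y → T < a y → Lowest y → Shortest y → B + B ≤ height y + fuel → Outcome
  climb fuel {y} T≤y T<a low short enough with anyUpTo? (better? y) B
  -- The end of row `y` has first coordinate `a y ∸ 1`, hence `suc T` in `x₀`.
  ... | no ¬better = inj₁ record { x₀ = a y ∸ suc T ; y₀ = y ∸ T ; inside = inside ; maximal = maximal }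
    where
    x₁ : suc (a y ∸ suc T + T) ≡ a y
    x₁ = trans (sym (+-suc _ T)) (m∸n+n≡m T<a)
    y₁ : y ∸ T + T ≡ y
    y₁ = m∸n+n≡m T≤y

    inside : InZ I (a y ∸ suc T + T) (y ∸ T + T)
    inside = <rowLength⇒inZ I (subst (λ q → a y ∸ suc T + T < a q) (sym y₁) (≤-reflexive x₁))

    maximal : ∀ {p q} → InZ I p q → a y ∸ suc T ≤ p → y ∸ T ≤ q → p + q ≤ (a y ∸ suc T + T) + (y ∸ T + T)
    maximal {p} {q} z x₀≤p y₀≤q = s≤s⁻¹ (begin
      suc p + q                              ≤⟨ +-monoˡ-≤ q p<aq ⟩
      height q                               ≤⟨ ≮⇒≥ (λ h< → ¬better (q , proj₂ (inB z) , y≤ , a≤ , h<)) ⟩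
      height y                               ≡⟨ sym (cong₂ _+_ x₁ y₁) ⟩
      suc (a y ∸ suc T + T) + (y ∸ T + T)    ∎)
      where
      p<aq : p < a q
      p<aq = inZ⇒<rowLength I z
      y≤ : y ≤ q + T
      y≤ = ≤-trans (≤-reflexive (sym y₁)) (+-monoˡ-≤ T y₀≤q)
      a≤ : a y ≤ a q + T
      a≤ = ≤-trans (≤-reflexive (sym x₁)) (+-monoˡ-≤ T (≤-trans (s≤s x₀≤p) p<aq))
  climb zero {y} T≤y T<a low short enough | yes _ = contradiction enough (<⇒≱ (begin-strict
      height y + 0   ≡⟨ +-identityʳ _ ⟩
      a y + y        <⟨ +-mono-≤-< (a≤B y) (proj₂ (inB (<rowLength⇒inZ I T<a))) ⟩
      B + B          ∎))
  climb (suc fuel) {y} T≤y T<a low short enough | yes (y′ , _ , step@(y≤ , a≤ , better)) with T ≤? y′ | T <? a y′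
  -- The index has fallen below `T`, and the path from the lowest record is already complete. In the
  -- next case the length has fallen to `T` or less, and `last` still has to be appended.
  ... | no T≰y′ | _ = inj₂ (_ , +-cancelʳ-≤ T s _ (begin
      s + T                          ≤⟨ many ⟩
      suc row + steps * T            ≤⟨ +-monoˡ-≤ (steps * T) (s≤s (≤-trans row≤y y≤)) ⟩
      suc y′ + T + steps * T         ≤⟨ +-monoˡ-≤ (steps * T) (+-monoˡ-≤ T (≰⇒> T≰y′)) ⟩
      T + T + steps * T              ≡⟨ +-assoc T T (steps * T) ⟩
      T + (T + steps * T)            ≡⟨ +-comm T _ ⟩
      suc steps * T + T              ∎) , subst (λ n → Path n B) (+-identityʳ steps) (fromRow start))
    where open Lowest low
  ... | yes _ | no T≮a = inj₂ (suc steps , (begin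
      s                              ≤⟨ many ⟩
      a row + steps * T              ≤⟨ +-monoˡ-≤ (steps * T) (≤-trans a-row≤a (≤-trans a≤ (+-monoˡ-≤ T (≮⇒≥ T≮a)))) ⟩
      T + T + steps * T              ≡⟨ +-assoc T T (steps * T) ⟩
      suc (suc steps) * T            ∎)
      , last toRow (≤-trans 1≤T T≤row) (≤-<-trans 1≤T T<a-row))
    where open Shortest short
  ... | yes T≤y′ | yes T<a′ =
      climb fuel T≤y′ T<a′ (lower low step T≤y′ T<a′) (shorten short step T≤y′ T<a′) (begin
        B + B                     ≤⟨ enough ⟩
        height y + suc fuel       ≡⟨ +-suc (height y) fuel ⟩
        suc (height y) + fuel     ≤⟨ +-monoˡ-≤ fuel better ⟩
        height y′ + fuel          ∎)

  search : (∀ p q → p < s → q < s → InZ I p q) → Outcome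
  search square with T <? s
  ... | no T≮s = inj₂ (0 , ≤-trans (≮⇒≥ T≮s) (≤-reflexive (sym (*-identityˡ T))) , start)
  ... | yes T<s = climb (B + B) T≤y T<a
      -- `Lowest` counts the concluding step `last` from the outset: hence `steps = 1`, and the
      -- summand `T` beside `s` in its `many`.
      record
        { T≤row = T≤y ; T<a-row = T<a ; row≤y = ≤-refl ; height≤ = ≤-refl ; steps = 1
        ; many = ≤-reflexive (cong₂ _+_ (sym 1+y) (sym (*-identityˡ T)))
        ; fromRow = λ path → last path (≤-trans 1≤T T≤y) (≤-<-trans 1≤T T<a) }
      record
        { T≤row = T≤y ; T<a-row = T<a ; a-row≤a = ≤-refl ; height≤ = ≤-refl ; steps = 0
        ; many = ≤-trans s≤a (m≤m+n _ 0)
        ; toRow = start }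
      (m≤n+m (B + B) (height (pred s)))
    where
    1+y : suc (pred s) ≡ s
    1+y = suc-pred s {{>-nonZero (≤-<-trans z≤n T<s)}}
    T≤y : T ≤ pred s
    T≤y = s≤s⁻¹ (subst (T <_) (sym 1+y) T<s)
    s≤a : s ≤ a (pred s)
    s≤a = ≤-from-< λ {p} p<s → inZ⇒<rowLength I (square p (pred s) p<s (≤-reflexive 1+y))
    T<a : T < a (pred s)
    T<a = <-≤-trans T<s s≤a

-- The bound

-- `T` is kept positive even for `s = 0`, where `T * T ≤ s` fails; the alternative `T ≡ 1` absorbs
-- this case.
squareRoot : ∀ s → Σ ℕ λ T → 1 ≤ T × s ≤ suc T * suc T × (T ≡ 1 ⊎ T * T ≤ s)
squareRoot zero = 1 , ≤-refl , z≤n , inj₁ refl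
squareRoot (suc s) with squareRoot s
... | T , 1≤T , s≤ , low with suc s ≤? suc T * suc T
...   | yes 1+s≤ = T , 1≤T , 1+s≤ , Sum.map₂ m≤n⇒m≤1+n low
...   | no 1+s≰ = suc T , s≤s z≤n , ≤-trans (s≤s s≤) (*-mono-< (n<1+n (suc T)) (n<1+n (suc T)))
                , inj₂ (<⇒≤ (≰⇒> 1+s≰))

-- From `T * T ≤ s ≤ n * T` follows `T ≤ n`, and then `n * T ≤ n * n`.
*-≤-square : ∀ {s T n} → 1 ≤ T → T ≡ 1 ⊎ T * T ≤ s → s ≤ n * T → s ≤ n * n
*-≤-square {n = zero} _ (inj₁ refl) s≤ = s≤
*-≤-square {n = n@(suc _)} _ (inj₁ refl) s≤ = ≤-trans s≤ (*-monoʳ-≤ n (s≤s z≤n))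
*-≤-square {T = T} {n} 1≤T (inj₂ T²≤s) s≤ =
  ≤-trans s≤ (*-monoʳ-≤ n (*-cancelʳ-≤ T n T {{>-nonZero 1≤T}} (≤-trans T²≤s s≤)))

-- The square is that of `suc N` because the filling time exceeds `N`.
slowEnhancement : ∀ I s → (∀ p q → p < s → q < s → InZ I p q) →
  Σ ℕ λ N → s ≤ suc N * suc N × SlowEnhancement I N
slowEnhancement I s square with bounded I | squareRoot s
... | B , inB | T , 1≤T , s≤ , low with Search.search I B inB T s 1≤T square
...   | inj₁ peak = T , s≤ , AtPeak.slow inB peak
...   | inj₂ (N , s≤N , path) = N , *-≤-square {n = suc N} 1≤T low s≤N , Staircase.staircase I B inB path

theorem1p4 : (I : List (ℕ × ℕ)) → ValidIndex I → I ≢ [] →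
    (s : ℕ) → IsS I s →
    Σ (ℕ → ℕ) (λ r → Σ (ℕ → ℕ) (λ c →
    WeaklyDecreasing r × WeaklyDecreasing c
    × FiniteSupport r × FiniteSupport c × SpansEn I r c
    × Σ ℕ (λ t → TauEn I r c t × s ≤ t * t)))
    × Σ (List (ℕ × ℕ)) (λ A → Thin A × Spans I A
    × Σ ℕ (λ t → Tau I A t × s ∸ 1 ≤ t * t))
    × Σ (List (ℕ × ℕ)) (λ A → Spans I A
    × Σ ℕ (λ t → Tau I A t × s ∸ 1 ≤ t * t))
theorem1p4 I _ _ s (square , _) with slowEnhancement I s square
... | N , s≤ , E with slow-enhanced E | slow-thin E
...   | t , τ , N<t | A , thin , spans , u , τ′ , N<u =
    ( r , c , r-decreasing , c-decreasing , r-finite , c-finite , (λ i j → time , fills i j)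
    , t , τ , ≤-trans s≤ (*-mono-≤ N<t N<t))
  , (A , thin , spans , u , τ′ , s-1≤u²)
  , (A , spans , u , τ′ , s-1≤u²)
  where
  open SlowEnhancement E
  s-1≤u² : s ∸ 1 ≤ u * u
  s-1≤u² = ≤-trans (m∸n≤m s 1) (≤-trans s≤ (*-mono-≤ N<u N<u))
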